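{- There are uncountably many Harary polynomials $\chi_{\mathcal{P}}$ (with $\mathcal{P}$ ranging over graph properties) which are d.p.-incomparable to the chromatic polynomial $\chi$.
   Context: All graphs are finite, simple, loop-free and have at least one vertex. A graph property $\mathcal{P}$ is a class of graphs closed under isomorphism. For a graph $G$ of order $n$, $h_i^{\mathcal{P}}(G)$ is the number of partitions of $V(G)$ into exactly $i$ nonempty blocks such that each block $B$ induces a graph $G[B]\in\mathcal{P}$. The Harary polynomial of $\mathcal{P}$ is the map $G\mapsto\chi_{\mathcal{P}}(G;k)=\sum_{i=1}^{n} h_i^{\mathcal{P}}(G)\,k_{(i)}\in\mathbb{Z}[k]$, where $k_{(i)}=k(k-1)\cdots(k-i+1)$. The chromatic polynomial $\chi$ is $\chi_{\mathcal{P}}$ for $\mathcal{P}$ the class of edgeless graphs. Two graph parameters $F_1,F_2$ are d.p.-incomparable if there are graphs $H_1,H_1',H_2,H_2'$ with $F_1(H_1)=F_1(H_1')$, $F_2(H_1)\neq F_2(H_1')$, $F_1(H_2)\neq F_1(H_2')$ and $F_2(H_2)=F_2(H_2')$. -}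

module Defs where

open import Level using (Level; 0ℓ; _⊔_) renaming (suc to lsuc)
open import Data.Bool using (Bool; false)
import Data.Bool.Properties as Bool
open import Data.Fin using (Fin; zero; suc)
open import Data.Fin.Properties using (all?)
open import Data.Fin.Subset using (Subset; inside; outside; Nonempty; Empty; _∈_; _∩_; ∣_∣)
open import Data.Fin.Subset.Properties using (nonempty?; _∈?_; x∈p⇒∣p-x∣<∣p∣)
open import Data.Integer as ℤ using (ℤ; +_; 0ℤ; 1ℤ)
open import Data.List using (List; []; _∷_; _++_; map; foldr; filter; length; upTo)
open import Data.List.Relation.Unary.All using (All)
import Data.List.Relation.Unary.All as All
open import Data.List.Relation.Unary.AllPairs using (AllPairs; allPairs?)
open import Data.List.Relation.Unary.Any using (Any; any?)
import Data.Maybe.Relation.Binary.Pointwise as Maybe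
open import Data.Nat using (ℕ; zero; suc; NonZero; >-nonZero; z≤n)
open import Data.Nat.Properties using (≤-<-trans)
open import Data.Product using (Σ-syntax; ∃-syntax; _×_; _,_)
open import Data.Vec using ([]; _∷_)
open import Function.Bundles using (_↔_; Surjection; module Inverse)
open import Relation.Binary.Bundles using (Setoid)
open import Relation.Binary.PropositionalEquality using (_≡_; refl; sym; trans; setoid)
open import Relation.Nullary using (¬_; yes; no; ¬?; _×-dec_)
open import Relation.Unary using (Pred; Decidable)

-- ℤ[k]: coefficient lists, constant term first, identified up to trailing zeros.

ℤ[k] : Set
ℤ[k] = List ℤ

coeff : ℤ[k] → ℕ → ℤ
coeff []      _       = 0ℤ
coeff (a ∷ _) zero    = a
coeff (_ ∷ p) (suc j) = coeff p j

infix  4 _≈_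
infixl 6 _⊕_
infixl 7 _⊗_ _·_

_≈_ : ℤ[k] → ℤ[k] → Set
p ≈ q = ∀ j → coeff p j ≡ coeff q j

_⊕_ : ℤ[k] → ℤ[k] → ℤ[k]
[]      ⊕ q       = q
(a ∷ p) ⊕ []      = a ∷ p
(a ∷ p) ⊕ (b ∷ q) = (a ℤ.+ b) ∷ (p ⊕ q)

_·_ : ℤ → ℤ[k] → ℤ[k]
a · p = map (a ℤ.*_) p

_⊗_ : ℤ[k] → ℤ[k] → ℤ[k]
[]      ⊗ q = []
(a ∷ p) ⊗ q = a · q ⊕ (0ℤ ∷ (p ⊗ q))

-- k₍ᵢ₎ = k (k - 1) ⋯ (k - i + 1); the new factor k - i has coefficients - i , 1.
fallingFactorial : ℕ → ℤ[k]
fallingFactorial zero    = 1ℤ ∷ []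
fallingFactorial (suc i) = fallingFactorial i ⊗ ((ℤ.- (+ i)) ∷ 1ℤ ∷ [])

-- The nonemptiness proof is irrelevant, so that it does not enter into equality of graphs.
record Graph : Set where
  field
    order          : ℕ
    .{{nonempty}}  : NonZero order
    adjacent       : Fin order → Fin order → Bool
    symmetric      : ∀ u v → adjacent u v ≡ adjacent v u
    loopFree       : ∀ v → adjacent v v ≡ false

open Graph public using (order; adjacent; symmetric; loopFree)

infix 4 _≅_

record _≅_ (G H : Graph) : Set where
  field
    bijection : Fin (order G) ↔ Fin (order H)
  open Inverse bijection public using (to; from)
  field
    preserves : ∀ u v → adjacent H (to u) (to v) ≡ adjacent G u v

-- Decidability is what makes the number of admissible partitions a natural number; classically
-- it holds for every class of graphs.
record GraphProperty : Set₁ where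
  field
    Holds      : Pred Graph 0ℓ
    holds?     : Decidable Holds
    respects-≅ : ∀ {G H} → G ≅ H → Holds G → Holds H

open GraphProperty public

-- The increasing enumeration of the elements of B.
element : ∀ {n} (B : Subset n) → Fin ∣ B ∣ → Fin n
element (inside  ∷ B) zero    = zero
element (inside  ∷ B) (suc j) = suc (element B j)
element (outside ∷ B) j       = suc (element B j)

∣∣-nonZero : ∀ {n} {B : Subset n} → Nonempty B → NonZero ∣ B ∣
∣∣-nonZero (_ , v∈B) = >-nonZero (≤-<-trans z≤n (x∈p⇒∣p-x∣<∣p∣ v∈B))

induced : (G : Graph) (B : Subset (order G)) → Nonempty B → Graph
induced G B ne = record
  { order     = ∣ B ∣
  ; nonempty  = ∣∣-nonZero ne
  ; adjacent  = λ u v → adjacent G (element B u) (element B v)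
  ; symmetric = λ u v → symmetric G (element B u) (element B v)
  ; loopFree  = λ v → loopFree G (element B v)
  }

subsets : ∀ n → List (Subset n)
subsets zero    = [] ∷ []
subsets (suc n) = map (inside ∷_) (subsets n) ++ map (outside ∷_) (subsets n)

-- The sublists of length i; if the entries of xs are distinct, each i-element set of entries
-- is listed exactly once.
combinations : ∀ {a} {A : Set a} → ℕ → List A → List (List A)
combinations zero    _        = [] ∷ []
combinations (suc i) []       = []
combinations (suc i) (x ∷ xs) = map (x ∷_) (combinations i xs) ++ combinations (suc i) xs

IsPartition : ∀ {n} → List (Subset n) → Set
IsPartition bs = All Nonempty bs
               × AllPairs (λ B C → Empty (B ∩ C)) bs
               × (∀ v → Any (v ∈_) bs)

isPartition? : ∀ {n} → Decidable (IsPartition {n})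
isPartition? bs = All.all? nonempty? bs
            ×-dec allPairs? (λ B C → ¬? (nonempty? (B ∩ C))) bs
            ×-dec all? (λ v → any? (v ∈?_) bs)

Induces : GraphProperty → (G : Graph) → Pred (Subset (order G)) 0ℓ
Induces P G B = Σ[ ne ∈ Nonempty B ] Holds P (induced G B ne)

induces? : ∀ P G → Decidable (Induces P G)
induces? P G B with nonempty? B
... | no  empty = no λ (ne , _) → empty ne
... | yes ne    with holds? P (induced G B ne)
...   | yes p = yes (ne , p)
...   | no ¬p = no λ (_ , p) → ¬p p

IsPPartition : GraphProperty → (G : Graph) → Pred (List (Subset (order G))) 0ℓ
IsPPartition P G bs = IsPartition bs × All (Induces P G) bs

isPPartition? : ∀ P G → Decidable (IsPPartition P G)
isPPartition? P G bs = isPartition? bs ×-dec All.all? (induces? P G) bs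

h : GraphProperty → Graph → ℕ → ℕ
h P G i = length (filter (isPPartition? P G) (combinations i (subsets (order G))))

GraphParameter : Set
GraphParameter = Graph → ℤ[k]

-- upTo n lists 0, …, n - 1, so the sum runs over i = suc j = 1, …, n.
harary : GraphProperty → GraphParameter
harary P G = foldr _⊕_ [] (map (λ j → (+ h P G (suc j)) · fallingFactorial (suc j)) (upTo (order G)))

edgeless : GraphProperty
edgeless = record
  { Holds      = λ G → ∀ u v → adjacent G u v ≡ false
  ; holds?     = λ G → all? λ u → all? λ v → adjacent G u v Bool.≟ false
  ; respects-≅ = λ {G} {H} → transfer G H
  }
  where
  transfer : ∀ G H → G ≅ H → (∀ u v → adjacent G u v ≡ false) → ∀ u v → adjacent H u v ≡ false
  transfer G H iso none u v
    with eq ← _≅_.preserves iso (_≅_.from iso u) (_≅_.from iso v)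
    rewrite Inverse.strictlyInverseˡ (_≅_.bijection iso) u
          | Inverse.strictlyInverseˡ (_≅_.bijection iso) v
    = trans eq (none _ _)

chromatic : GraphParameter
chromatic = harary edgeless

DPIncomparable : GraphParameter → GraphParameter → Set
DPIncomparable F₁ F₂ =
    (∃[ H₁ ] ∃[ H₁′ ] F₁ H₁ ≈ F₁ H₁′ × ¬ (F₂ H₁ ≈ F₂ H₁′))
  × (∃[ H₂ ] ∃[ H₂′ ] ¬ (F₁ H₂ ≈ F₁ H₂′) × F₂ H₂ ≈ F₂ H₂′)

-- The set { χ_P | P a graph property, χ_P d.p.-incomparable to F }: two properties present the
-- same element when their Harary polynomials agree as maps on graphs.
hararyIncomparableTo : GraphParameter → Setoid (lsuc 0ℓ) 0ℓ
hararyIncomparableTo F = record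
  { Carrier       = Σ[ P ∈ GraphProperty ] DPIncomparable (harary P) F
  ; _≈_           = λ (P , _) (Q , _) → ∀ G → harary P G ≈ harary Q G
  ; isEquivalence = record
    { refl  = λ _ _ → refl
    ; sym   = λ e G j → sym (e G j)
    ; trans = λ e f G j → trans (e G j) (f G j)
    }
  }

-- S is countable when ℕ surjects onto S with one extra point adjoined; the extra point lets
-- empty S count as countable.
Countable : ∀ {c ℓ : Level} → Setoid c ℓ → Set (c ⊔ ℓ)
Countable S = Surjection (setoid ℕ) (Maybe.setoid S)

Uncountable : ∀ {c ℓ : Level} → Setoid c ℓ → Set (c ⊔ ℓ)
Uncountable S = ¬ Countable S

{-# OPTIONS --safe #-}

-- Given A : ℕ → Bool, let P_A consist of the graphs without a universal vertex whose order is
-- 4, or 5 + n with A n true.  Since k₍ᵢ₎ vanishes at k = 1 for i ≥ 2, χ_P(G; 1) = h₁(G), which is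
-- nonzero exactly when G has P.  Hence χ_{P_A} separates the path and the star on four vertices,
-- which are chromatically equivalent, while it vanishes on both K₁ and K₂; and A n can be read
-- off from χ_{P_A} at the edgeless graph of order 5 + n, so Cantor's diagonal argument applies.
module Submission where

open import Defs

open import Data.Bool using (Bool; true; false; T; _xor_)
open import Data.Bool.Properties using (T?; xor-comm; xor-same)
import Data.Bool.Properties as Bool
open import Data.Fin using (Fin; zero; suc; toℕ; cast)
open import Data.Fin.Properties using (all?; any?; cast-involutive)
open import Data.Fin.Permutation using (↔⇒≡)
import Data.Fin.Properties as Fin
open import Data.Fin.Subset using (inside; Nonempty; ⊤; _∈_; ∣_∣)
open import Data.Fin.Subset.Properties using (∈⊤; ∣⊤∣≡n; ⊆-antisym; ⊆-max)
open import Data.Integer as ℤ using (ℤ; +_; 0ℤ; 1ℤ)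
import Data.Integer.Properties as ℤ
open import Data.Integer.Tactic.RingSolver using (solve-∀)
open import Data.List using (List; []; _∷_; map; foldr; applyUpTo; length)
open import Data.List.Membership.Propositional using () renaming (_∈_ to _∈ₗ_)
open import Data.List.Membership.Propositional.Properties using (∈-map⁺; ∈-++⁺ˡ; ∈-filter⁺)
open import Data.List.Properties using (filter-none)
open import Data.List.Relation.Unary.All using (All; []; _∷_)
open import Data.List.Relation.Unary.All.Properties using (map⁺; applyUpTo⁺₂)
open import Data.List.Relation.Unary.AllPairs using ([]; _∷_)
open import Data.List.Relation.Unary.Any using (here; there)
open import Data.Maybe using (Maybe; just; nothing)
open import Data.Maybe.Relation.Binary.Pointwise as Maybe using (just)
open import Data.Nat using (ℕ; zero; suc; NonZero; _≡ᵇ_; ∣_-_∣)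
open import Data.Nat.Properties using (∣-∣-comm; ∣n-n∣≡0)
open import Data.Product using (∃-syntax; _×_; _,_; proj₁; proj₂)
open import Data.Unit using (tt)
open import Data.Vec using (_∷_)
open import Function.Bundles using (Surjection; mk↔ₛ′; module Inverse)
open import Relation.Binary.Bundles using (Setoid)
open import Relation.Binary.PropositionalEquality using (_≡_; _≢_; refl; sym; trans; cong; cong₂; subst; module ≡-Reasoning)
open import Relation.Nullary using (¬_; Dec; yes; no; does; ¬?; _×-dec_)
open import Relation.Nullary.Decidable using (toWitness; toWitnessFalse)

-- Evaluation at k = 1, as the sum of the coefficients

eval₁ : ℤ[k] → ℤ
eval₁ = foldr ℤ._+_ 0ℤ

-- Equal polynomials may be lists of different lengths: when one list runs out, the remaining
-- coefficients of the other all vanish.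
eval₁-zero : ∀ p → (∀ j → coeff p j ≡ 0ℤ) → eval₁ p ≡ 0ℤ
eval₁-zero []      _ = refl
eval₁-zero (a ∷ p) z = cong₂ ℤ._+_ (z 0) (eval₁-zero p λ j → z (suc j))

eval₁-cong : ∀ p q → p ≈ q → eval₁ p ≡ eval₁ q
eval₁-cong []      q       e = sym (eval₁-zero q λ j → sym (e j))
eval₁-cong (a ∷ p) []      e = eval₁-zero (a ∷ p) e
eval₁-cong (a ∷ p) (b ∷ q) e = cong₂ ℤ._+_ (e 0) (eval₁-cong p q λ j → e (suc j))

eval₁-⊕ : ∀ p q → eval₁ (p ⊕ q) ≡ eval₁ p ℤ.+ eval₁ q
eval₁-⊕ []      q       = sym (ℤ.+-identityˡ (eval₁ q))
eval₁-⊕ (a ∷ p) []      = sym (ℤ.+-identityʳ (eval₁ (a ∷ p)))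
eval₁-⊕ (a ∷ p) (b ∷ q) = trans (cong (λ x → (a ℤ.+ b) ℤ.+ x) (eval₁-⊕ p q)) (interchange a b (eval₁ p) (eval₁ q))
  where
  interchange : ∀ a b x y → (a ℤ.+ b) ℤ.+ (x ℤ.+ y) ≡ (a ℤ.+ x) ℤ.+ (b ℤ.+ y)
  interchange = solve-∀

eval₁-· : ∀ a p → eval₁ (a · p) ≡ a ℤ.* eval₁ p
eval₁-· a []      = sym (ℤ.*-zeroʳ a)
eval₁-· a (b ∷ p) = trans (cong (λ x → a ℤ.* b ℤ.+ x) (eval₁-· a p)) (sym (ℤ.*-distribˡ-+ a b (eval₁ p)))

eval₁-⊗ : ∀ p q → eval₁ (p ⊗ q) ≡ eval₁ p ℤ.* eval₁ q
eval₁-⊗ []      q = refl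
eval₁-⊗ (a ∷ p) q = begin
  eval₁ (a · q ⊕ (0ℤ ∷ (p ⊗ q)))               ≡⟨ eval₁-⊕ (a · q) (0ℤ ∷ (p ⊗ q)) ⟩
  eval₁ (a · q) ℤ.+ (0ℤ ℤ.+ eval₁ (p ⊗ q))     ≡⟨ cong₂ ℤ._+_ (eval₁-· a q) (trans (ℤ.+-identityˡ _) (eval₁-⊗ p q)) ⟩
  a ℤ.* eval₁ q ℤ.+ eval₁ p ℤ.* eval₁ q        ≡⟨ ℤ.*-distribʳ-+ (eval₁ q) a (eval₁ p) ⟨
  (a ℤ.+ eval₁ p) ℤ.* eval₁ q                  ∎
  where open ≡-Reasoning

-- The base case k (k - 1) already contains the factor k - 1, and each further factor keeps the root
-- at k = 1.
eval₁-fallingFactorial : ∀ i → eval₁ (fallingFactorial (suc (suc i))) ≡ 0ℤ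
eval₁-fallingFactorial zero    = refl
eval₁-fallingFactorial (suc i) =
  trans (eval₁-⊗ (fallingFactorial (suc (suc i))) factor) (cong (ℤ._* eval₁ factor) (eval₁-fallingFactorial i))
  where
  factor : ℤ[k]
  factor = (ℤ.- (+ suc (suc i))) ∷ 1ℤ ∷ []

eval₁-sum-zero : ∀ {ps} → All (λ p → eval₁ p ≡ 0ℤ) ps → eval₁ (foldr _⊕_ [] ps) ≡ 0ℤ
eval₁-sum-zero                []       = refl
eval₁-sum-zero {ps = p ∷ ps} (z ∷ zs) = trans (eval₁-⊕ p (foldr _⊕_ [] ps)) (cong₂ ℤ._+_ z (eval₁-sum-zero zs))

eval₁-harary : ∀ P G → eval₁ (harary P G) ≡ + h P G 1
-- Matching on `suc m` unfolds `upTo`, so that the term for i = 1 is separated from the terms that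
-- vanish at k = 1.
eval₁-harary P G@record { order = suc m } = begin
  eval₁ (term 0 ⊕ rest)             ≡⟨ eval₁-⊕ (term 0) rest ⟩
  eval₁ (term 0) ℤ.+ eval₁ rest     ≡⟨ cong₂ ℤ._+_ (eval₁-· (+ h P G 1) (fallingFactorial 1)) rest-zero ⟩
  (+ h P G 1) ℤ.* 1ℤ ℤ.+ 0ℤ         ≡⟨ ℤ.+-identityʳ _ ⟩
  (+ h P G 1) ℤ.* 1ℤ                ≡⟨ ℤ.*-identityʳ _ ⟩
  + h P G 1                         ∎
  where
  open ≡-Reasoning
  term : ℕ → ℤ[k]
  term j = (+ h P G (suc j)) · fallingFactorial (suc j)
  rest : ℤ[k]
  rest = foldr _⊕_ [] (map term (applyUpTo suc m))
  term-zero : ∀ j → eval₁ (term (suc j)) ≡ 0ℤ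
  term-zero j = trans (eval₁-· (+ h P G (suc (suc j))) (fallingFactorial (suc (suc j))))
    (trans (cong (λ x → (+ h P G (suc (suc j))) ℤ.* x) (eval₁-fallingFactorial j)) (ℤ.*-zeroʳ (+ h P G (suc (suc j)))))
  rest-zero : eval₁ rest ≡ 0ℤ
  rest-zero = eval₁-sum-zero (map⁺ (applyUpTo⁺₂ suc m term-zero))

-- Partitions into a single block

element-⊤ : ∀ {n} (j : Fin ∣ ⊤ {n} ∣) → element ⊤ j ≡ cast (∣⊤∣≡n n) j
element-⊤ {suc n} zero    = refl
element-⊤ {suc n} (suc j) = cong suc (element-⊤ j)

-- The two orders agree only up to `∣⊤∣≡n`, so the comparison is an isomorphism by `cast`, along
-- which `respects-≅` carries a property.
induced-⊤ : ∀ G (ne : Nonempty ⊤) → induced G ⊤ ne ≅ G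
induced-⊤ G ne = record
  { bijection = mk↔ₛ′ (cast eq) (cast (sym eq)) (cast-involutive eq (sym eq)) (cast-involutive (sym eq) eq)
  ; preserves = λ u v → sym (cong₂ (adjacent G) (element-⊤ u) (element-⊤ v))
  }
  where eq = ∣⊤∣≡n (order G)

≅-sym : ∀ {G H} → G ≅ H → H ≅ G
≅-sym {G} {H} iso = record
  { bijection = mk↔ₛ′ from to strictlyInverseʳ strictlyInverseˡ
  ; preserves = λ u v → trans (sym (_≅_.preserves iso (from u) (from v)))
                              (cong₂ (adjacent H) (strictlyInverseˡ u) (strictlyInverseˡ v))
  }
  where open Inverse (_≅_.bijection iso)

⊤∈subsets : ∀ n → ⊤ ∈ₗ subsets n
⊤∈subsets zero    = here refl
⊤∈subsets (suc n) = ∈-++⁺ˡ (∈-map⁺ (inside ∷_) (⊤∈subsets n))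

combinations₁⁺ : ∀ {a} {A : Set a} {x : A} {xs} → x ∈ₗ xs → (x ∷ []) ∈ₗ combinations 1 xs
combinations₁⁺ (here refl) = here refl
combinations₁⁺ (there x∈)  = there (combinations₁⁺ x∈)

all-combinations₁ : ∀ {a p} {A : Set a} {P : List A → Set p} (xs : List A) →
                    (∀ x → P (x ∷ [])) → All P (combinations 1 xs)
all-combinations₁ []       _ = []
all-combinations₁ (x ∷ xs) f = f x ∷ all-combinations₁ xs f

nonempty-⊤ : ∀ G → Nonempty (⊤ {order G})
nonempty-⊤ record { order = suc _ } = zero , ∈⊤

isPPartition-⊤ : ∀ P G → Holds P G → IsPPartition P G (⊤ ∷ [])
isPPartition-⊤ P G p =
  (ne ∷ [] , [] ∷ [] , λ _ → here ∈⊤) , (ne , respects-≅ P (≅-sym (induced-⊤ G ne)) p) ∷ []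
  where ne = nonempty-⊤ G

holds-of-singleton : ∀ P G B → IsPPartition P G (B ∷ []) → Holds P G
holds-of-singleton P G B ((_ , _ , cover) , (ne , p) ∷ []) = go B≡⊤ ne p
  where
  B≡⊤ : B ≡ ⊤
  -- A lone block has to cover every vertex.
  B≡⊤ = ⊆-antisym (⊆-max B) λ {v} _ → only (cover v)
    where
    only : ∀ {v} → _ → v ∈ B
    only (here v∈B) = v∈B
  -- The block is generalised together with its nonemptiness proof, on which the induced graph
  -- depends, so that matching on `refl` replaces it by `⊤`.
  go : ∀ {B} → B ≡ ⊤ → (ne : Nonempty B) → Holds P (induced G B ne) → Holds P G
  go refl ne p = respects-≅ P (induced-⊤ G ne) p

-- The partition with the single block `⊤` is admissible, so the list counted by `h P G 1` has a
-- member.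
eval₁-harary-nonzero : ∀ P G → Holds P G → eval₁ (harary P G) ≢ 0ℤ
eval₁-harary-nonzero P G p eq = nonzero
  (∈-filter⁺ (isPPartition? P G) (combinations₁⁺ (⊤∈subsets (order G))) (isPPartition-⊤ P G p))
  (ℤ.+-injective (trans (sym (eval₁-harary P G)) eq))
  where
  nonzero : ∀ {a} {A : Set a} {x : A} {xs} → x ∈ₗ xs → length xs ≢ 0
  nonzero (here _)  ()
  nonzero (there _) ()

eval₁-harary-zero : ∀ P G → ¬ Holds P G → eval₁ (harary P G) ≡ 0ℤ
eval₁-harary-zero P G ¬p = trans (eval₁-harary P G) (cong (λ xs → + length xs)
  (filter-none (isPPartition? P G) (all-combinations₁ (subsets (order G)) λ B q → ¬p (holds-of-singleton P G B q))))

-- Concrete graphs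

path : ∀ n .{{_ : NonZero n}} → Graph
path n = record
  { order     = n
  ; adjacent  = λ u v → ∣ toℕ u - toℕ v ∣ ≡ᵇ 1
  ; symmetric = λ u v → cong (_≡ᵇ 1) (∣-∣-comm (toℕ u) (toℕ v))
  ; loopFree  = λ v → cong (_≡ᵇ 1) (∣n-n∣≡0 (toℕ v))
  }

star : ∀ n .{{_ : NonZero n}} → Graph
star n = record
  { order     = n
  ; adjacent  = λ u v → centre u xor centre v
  ; symmetric = λ u v → xor-comm (centre u) (centre v)
  ; loopFree  = λ v → xor-same (centre v)
  }
  where
  centre : Fin n → Bool
  centre v = toℕ v ≡ᵇ 0

edgelessGraph : ∀ n .{{_ : NonZero n}} → Graph
edgelessGraph n = record
  { order     = n
  ; adjacent  = λ _ _ → false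
  ; symmetric = λ _ _ → refl
  ; loopFree  = λ _ → refl
  }

-- Both graphs are trees on four vertices, with chromatic polynomial k (k - 1)^3; the two
-- coefficient lists compute to the same list.
path₄-star₄-chromatic : chromatic (path 4) ≡ chromatic (star 4)
path₄-star₄-chromatic = refl

-- Graph properties indexed by sets of naturals

NoUniversalVertex : Graph → Set
-- `v ≢ u` is demanded because loop-freeness makes every vertex nonadjacent to itself.
NoUniversalVertex G = ∀ u → ∃[ v ] v ≢ u × adjacent G u v ≡ false

noUniversalVertex? : ∀ G → Dec (NoUniversalVertex G)
noUniversalVertex? G = all? λ u → any? λ v → ¬? (v Fin.≟ u) ×-dec (adjacent G u v Bool.≟ false)

noUniversalVertex-resp-≅ : ∀ {G H} → G ≅ H → NoUniversalVertex G → NoUniversalVertex H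
noUniversalVertex-resp-≅ {G} {H} iso none u with none (Inverse.from (_≅_.bijection iso) u)
... | v , v≢ , nonadj = to v , (λ eq → v≢ (trans (sym (strictlyInverseʳ v)) (cong from eq))) ,
  (trans (cong (λ w → adjacent H w (to v)) (sym (strictlyInverseˡ u))) (trans (_≅_.preserves iso (from u) v) nonadj))
  where open Inverse (_≅_.bijection iso)

-- Orders below 5 are treated alike for all `A`, so the same graphs witness incomparability
-- throughout; `A` is coded in the orders from 5 on.
admissibleOrder : (ℕ → Bool) → ℕ → Bool
admissibleOrder A 4                               = true
admissibleOrder A (suc (suc (suc (suc (suc n))))) = A n
admissibleOrder A _                               = false

family : (ℕ → Bool) → GraphProperty
family A = record
  { Holds      = λ G → T (admissibleOrder A (order G)) × NoUniversalVertex G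
  ; holds?     = λ G → T? (admissibleOrder A (order G)) ×-dec noUniversalVertex? G
  ; respects-≅ = λ {G} {H} iso (t , none) →
      subst (λ n → T (admissibleOrder A n)) (↔⇒≡ (_≅_.bijection iso)) t ,
      noUniversalVertex-resp-≅ {G} {H} iso none
  }

family-incomparable : ∀ A → DPIncomparable (harary (family A)) chromatic
family-incomparable A =
  -- The chromatic polynomials k and k (k - 1) differ in the coefficient of k, which is 1 and -1
  -- respectively.
  (path 1 , path 2 , small , (λ e → 1≢-1 (e 1))) ,
  (path 4 , star 4 , separated , λ j → cong (λ p → coeff p j) path₄-star₄-chromatic)
  where
  small : harary (family A) (path 1) ≈ harary (family A) (path 2)
  -- Orders 1 and 2 are inadmissible, so both polynomials are zero, but as lists of lengths 2 and 3.
  small zero                = refl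
  small (suc zero)          = refl
  small (suc (suc zero))    = refl
  small (suc (suc (suc _))) = refl
  1≢-1 : 1ℤ ≢ ℤ.-1ℤ
  1≢-1 ()
  -- Each vertex of the path misses another one, while the centre of the star is universal; both
  -- facts are decided by computation.
  path-holds : Holds (family A) (path 4)
  path-holds = tt , toWitness {a? = noUniversalVertex? (path 4)} tt
  star-fails : ¬ Holds (family A) (star 4)
  star-fails (_ , none) = toWitnessFalse {a? = noUniversalVertex? (star 4)} tt none
  separated : ¬ (harary (family A) (path 4) ≈ harary (family A) (star 4))
  separated e = eval₁-harary-nonzero (family A) (path 4) path-holds
    (trans (eval₁-cong (harary (family A) (path 4)) (harary (family A) (star 4)) e)
           (eval₁-harary-zero (family A) (star 4) star-fails))

-- The diagonal argument

testGraph : ℕ → Graph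
testGraph n = edgelessGraph (suc (suc (suc (suc (suc n)))))

noUniversalVertex-testGraph : ∀ n → NoUniversalVertex (testGraph n)
noUniversalVertex-testGraph n zero    = suc zero , (λ ()) , refl
noUniversalVertex-testGraph n (suc _) = zero , (λ ()) , refl

holds-testGraph : ∀ A n → T (A n) → Holds (family A) (testGraph n)
holds-testGraph A n t = t , noUniversalVertex-testGraph n

-- The diagonal bit: true exactly when the presented polynomial vanishes at k = 1 on `testGraph n`.
-- The value at `nothing` is arbitrary, as `nothing` is never related to a `just`.
refute : ℕ → Maybe (Setoid.Carrier (hararyIncomparableTo chromatic)) → Bool
refute n nothing        = false
refute n (just (Q , _)) = does (eval₁ (harary Q (testGraph n)) ℤ.≟ 0ℤ)

-- If the polynomial of `Q` vanishes at k = 1 on the test graph, then `A n` is true and that of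
-- `family A` does not vanish there; otherwise `A n` is false and it does. The values differ either
-- way.
refute-sound : ∀ A n x {incomparable} → A n ≡ refute n x →
               ¬ Setoid._≈_ (Maybe.setoid (hararyIncomparableTo chromatic)) x (just (family A , incomparable))
refute-sound A n (just (Q , _)) eq (just e)
  with eval₁-cong (harary Q (testGraph n)) (harary (family A) (testGraph n)) (e (testGraph n))
     | eval₁ (harary Q (testGraph n)) ℤ.≟ 0ℤ
... | same | yes z = eval₁-harary-nonzero (family A) (testGraph n)
                       (holds-testGraph A n (subst T (sym eq) tt)) (trans (sym same) z)
... | same | no nz = nz (trans same (eval₁-harary-zero (family A) (testGraph n) λ (t , _) → subst T eq t))

theorem7p2 : Uncountable (hararyIncomparableTo chromatic)
-- `n` is an index at which the enumeration hits the diagonal family; `refl` works since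
-- `diagonal n` unfolds to `refute n (to n)`.
theorem7p2 enumeration = refute-sound diagonal n (to n) refl hit
  where
  open Surjection enumeration using (to; strictlySurjective)
  diagonal : ℕ → Bool
  diagonal n = refute n (to n)
  preimage = strictlySurjective (just (family diagonal , family-incomparable diagonal))
  n   = proj₁ preimage
  hit = proj₂ preimage
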